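{- Let $(A,B)$ be an interpolation problem and let $a=b$ be a mixed literal, with $a$ $A$-local and $b$ $B$-local, and auxiliary variables $x$ (of the same type as $a$ and $b$) and $p_x$ (Boolean). Suppose that $I_1[EQ(x,s_1)]\ldots[EQ(x,s_n)]$ is a partial interpolant of the clause $C_1\lor a=b$, where $s_1,\ldots,s_n$ are terms, the sub-formulae $EQ(x,s_i) := (p_x \mathrel{\mathrm{xor}} (x=s_i))$ occur only positively, and $x$ and $p_x$ occur nowhere in this formula except as the displayed $x$ and $p_x$ in the $EQ(x,s_i)$. Suppose that $I_2(x)$ is a partial interpolant of the clause $C_2\lor a\neq b$ (where $x$ may occur at arbitrary positions). Then $I_1[I_2(s_1)]\ldots[I_2(s_n)]$, obtained by replacing each $EQ(x,s_i)$ by $I_2(s_i)$ (that is, $I_2$ with every $x$ substituted by $s_i$), is a partial interpolant of the clause $C_1\lor C_2$.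
   Context: Formulae are quantifier-free first-order formulae in the combined theory of equality with uninterpreted functions and linear arithmetic over $\mathbb{Q}$ and $\mathbb{Z}$ (with the integer division-by-constant functions $\lfloor\cdot/k\rfloor$, $k\ge 1$, in the signature); $\models$ is entailment in this theory. $\mathrm{symb}(F)$ is the set of non-theory symbols of $F$. An interpolation problem is a pair $(A,B)$ of formulae with $A\land B\models\bot$. A symbol is shared if it is in $\mathrm{symb}(A)\cap\mathrm{symb}(B)$, $A$-local if in $\mathrm{symb}(A)\setminus\mathrm{symb}(B)$, $B$-local if in $\mathrm{symb}(B)\setminus\mathrm{symb}(A)$. A term/literal is $A$-local ($B$-local) if it contains at least one $A$-local ($B$-local) symbol and no $B$-local ($A$-local) symbol, shared if it contains only shared symbols, mixed if it contains both $A$-local and $B$-local symbols. Projections. Each literal $\ell$ has projections $\ell\downharpoonright A$, $\ell\downharpoonright B$, extended to conjunctions of literals component-wise. For non-mixed literals: if $\ell$ is $A$-local, $\ell\downharpoonright A=\ell$ and $\ell\downharpoonright B=\top$; if $\ell$ is $B$-local, $\ell\downharpoonright A=\top$ and $\ell\downharpoonright B=\ell$; if $\ell$ is shared, then either (Pudlák) $\ell\downharpoonright A=\ell\downharpoonright B=\ell$, or (McMillan) $\ell\downharpoonright A=\top$, $\ell\downharpoonright B=\ell$, the choice being fixed throughout. For mixed literals, fresh auxiliary variables are used: $(a=b)\downharpoonright A := (a=x)$, $(a=b)\downharpoonright B := (x=b)$; $(a\neq b)\downharpoonright A := (p_x \mathrel{\mathrm{xor}} (a=x))$, $(a\neq b)\downharpoonright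 B := (\lnot p_x \mathrel{\mathrm{xor}} (x=b))$, with the same $x$ for $a=b$ and $a\ne b$; $(a+b\le c)\downharpoonright A := (a+x\le 0)$, $(a+b\le c)\downharpoonright B := (-x+b\le c)$, where $a$ is a linear combination of $A$-local variables, $b$ a linear combination of $B$-local and shared variables, $c$ a constant; a mixed inequality and its negation (rewritten as an inequality of the same form) have different auxiliary variables. Auxiliary variables belonging to different atoms are distinct, are fresh (do not occur in $A$, $B$ or the clauses), and count as shared symbols. Partial interpolant. A partial interpolant of a clause $C$ is a formula $I$ that is an interpolant of $A\land(\lnot C\downharpoonright A)$ and $B\land(\lnot C\downharpoonright B)$ ($\lnot C$ being a conjunction of literals), i.e. (i) $A\land\lnot C\downharpoonright A\models I$, (ii) $B\land\lnot C\downharpoonright B\land I\models\bot$, (iii) every non-theory symbol of $I$ is in $\mathrm{symb}(A)\cap\mathrm{symb}(B)$ or is an auxiliary variable introduced by the projections of the literals of $\lnot C$. $F[G_1]\ldots[G_n]$ denotes a formula in negation normal form with sub-formulae $G_1,\ldots,G_n$ occurring positively; $F[G_1']\ldots[G_n']$ is the result of replacing them by $G_1',\ldots,G_n'$. $F(t)$ denotes a formula with a sub-term $t$ that can appear anywhere, and $F(t')$ is the result of substituting $t'$ for it. Clauses are built over the literals of the proof, and $C_1,C_2$ contain neither the pivot literal nor its negation. -}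

module Defs where

open import Data.Bool.Base using (Bool; true)
import Data.Bool.Base as Bool
open import Data.Empty using (⊥)
open import Data.Fin.Base using (Fin)
open import Data.Integer.Base as ℤ using (ℤ; 0ℤ; 1ℤ; -1ℤ)
open import Data.Integer.DivMod using (_/ℕ_)
open import Data.List.Base using (List; []; _∷_; _++_; map; foldr; concatMap)
open import Data.List.Membership.Propositional using (_∈_; _∉_)
open import Data.List.Relation.Unary.All using (All; []; _∷_)
open import Data.List.Relation.Unary.Any using (Any)
open import Data.Nat.Base using (ℕ; NonZero)
open import Data.Product.Base using (∃₂; _×_; _,_)
open import Data.Rational.Base as ℚ using (ℚ; 0ℚ; 1ℚ)
open import Data.Sum.Base using (_⊎_)
open import Data.Unit.Base using (⊤)
open import Relation.Binary.Definitions using (DecidableEquality)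
open import Relation.Binary.PropositionalEquality using (_≡_; refl)
open import Relation.Nullary using (¬_; yes; no)

data Arith : Set where
  int rat : Arith

Num : Arith → Set
Num int = ℤ
Num rat = ℚ

0# : ∀ κ → Num κ
0# int = 0ℤ
0# rat = 0ℚ

-1# : ∀ κ → Num κ
-1# int = -1ℤ
-1# rat = ℚ.- 1ℚ

add mul : ∀ κ → Num κ → Num κ → Num κ
add int = ℤ._+_
add rat = ℚ._+_
mul int = ℤ._*_
mul rat = ℚ._*_

negate : ∀ κ → Num κ → Num κ
negate int = ℤ.-_
negate rat = ℚ.-_

leq : ∀ κ → Num κ → Num κ → Set
leq int = ℤ._≤_
leq rat = ℚ._≤_

data Sort (U : Set) : Set where
  bool   : Sort U
  unint  : U → Sort U
  arith  : Arith → Sort U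

-- Predicate symbols are the symbols of codomain bool; free variables and
-- propositional variables are the nullary symbols.
record Signature : Set₁ where
  field
    USort : Set
    Sym   : List (Sort USort) → Sort USort → Set
    _≟_   : DecidableEquality (∃₂ Sym)

module _ {S : Signature} where
  open Signature S

  Srt : Set
  Srt = Sort USort

  Symbol : Set
  Symbol = ∃₂ Sym

  symbol : ∀ {Γ τ} → Sym Γ τ → Symbol
  symbol f = _ , _ , f

  infixl 7 _⊙_
  infixl 6 _⊕_
  infix  5 _≈_ _≼_ _≼ᵇ_

  data Term : Srt → Set where
    app   : ∀ {Γ τ} → Sym Γ τ → All Term Γ → Term τ
    const : ∀ {κ} → Num κ → Term (arith κ)
    _⊕_   : ∀ {κ} → Term (arith κ) → Term (arith κ) → Term (arith κ)
    _⊙_   : ∀ {κ} → Num κ → Term (arith κ) → Term (arith κ)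
    ⌊_/_⌋ : Term (arith int) → (k : ℕ) → .{{NonZero k}} → Term (arith int)
    toℚ   : Term (arith int) → Term (arith rat)

  data Atom : Set where
    prop : Term bool → Atom
    _≈_  : ∀ {σ} → Term σ → Term σ → Atom
    _≼_  : ∀ {κ} → Term (arith κ) → Term (arith κ) → Atom

  infix  4 ¬ᶠ_
  infixr 3 _∧ᶠ_
  infixr 2 _∨ᶠ_ _xor_

  data Formula : Set where
    ⊤ᶠ ⊥ᶠ     : Formula
    atom      : Atom → Formula
    ¬ᶠ_       : Formula → Formula
    _∧ᶠ_ _∨ᶠ_ : Formula → Formula → Formula

  _xor_ : Formula → Formula → Formula
  F xor G = (F ∧ᶠ (¬ᶠ G)) ∨ᶠ ((¬ᶠ F) ∧ᶠ G)

  ⋀ : List Formula → Formula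
  ⋀ = foldr _∧ᶠ_ ⊤ᶠ

  data Literal : Set where
    pos neg : Atom → Literal

  flip : Literal → Literal
  flip (pos α) = neg α
  flip (neg α) = pos α

  literal : Literal → Formula
  literal (pos α) = atom α
  literal (neg α) = ¬ᶠ atom α

  -- Formulae in negation normal form with n placeholders.  Placeholders are
  -- never negated, so whatever is plugged in occurs positively.
  data NNF (n : ℕ) : Set where
    ⊤ⁿ ⊥ⁿ     : NNF n
    lit       : Literal → NNF n
    hole      : Fin n → NNF n
    _∧ⁿ_ _∨ⁿ_ : NNF n → NNF n → NNF n

  plug : ∀ {n} → NNF n → (Fin n → Formula) → Formula
  plug ⊤ⁿ       G = ⊤ᶠ
  plug ⊥ⁿ       G = ⊥ᶠ
  plug (lit ℓ)  G = literal ℓ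
  plug (hole i) G = G i
  plug (E ∧ⁿ F) G = plug E G ∧ᶠ plug F G
  plug (E ∨ⁿ F) G = plug E G ∨ᶠ plug F G

  symbᵗ  : ∀ {σ} → Term σ → List Symbol
  symbᵗˢ : ∀ {Γ} → All Term Γ → List Symbol
  symbᵗ (app f ts) = symbol f ∷ symbᵗˢ ts
  symbᵗ (const c)  = []
  symbᵗ (s ⊕ t)    = symbᵗ s ++ symbᵗ t
  symbᵗ (c ⊙ t)    = symbᵗ t
  symbᵗ ⌊ t / k ⌋  = symbᵗ t
  symbᵗ (toℚ t)    = symbᵗ t
  symbᵗˢ []        = []
  symbᵗˢ (t ∷ ts)  = symbᵗ t ++ symbᵗˢ ts

  symbᵃ : Atom → List Symbol
  symbᵃ (prop t) = symbᵗ t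
  symbᵃ (s ≈ t)  = symbᵗ s ++ symbᵗ t
  symbᵃ (s ≼ t)  = symbᵗ s ++ symbᵗ t

  symb : Formula → List Symbol
  symb ⊤ᶠ       = []
  symb ⊥ᶠ       = []
  symb (atom α) = symbᵃ α
  symb (¬ᶠ F)   = symb F
  symb (F ∧ᶠ G) = symb F ++ symb G
  symb (F ∨ᶠ G) = symb F ++ symb G

  symbˡ : Literal → List Symbol
  symbˡ ℓ = symb (literal ℓ)

  symbⁿ : ∀ {n} → NNF n → List Symbol
  symbⁿ F = symb (plug F (λ _ → ⊤ᶠ))

  subᵗ  : ∀ {σ τ} → Sym [] σ → Term σ → Term τ → Term τ
  subᵗˢ : ∀ {σ Γ} → Sym [] σ → Term σ → All Term Γ → All Term Γ
  subᵗ x s (app f ts) with symbol f ≟ symbol x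
  ... | yes refl = s
  ... | no _     = app f (subᵗˢ x s ts)
  subᵗ x s (const c) = const c
  subᵗ x s (t ⊕ u)   = subᵗ x s t ⊕ subᵗ x s u
  subᵗ x s (c ⊙ t)   = c ⊙ subᵗ x s t
  subᵗ x s ⌊ t / k ⌋ = ⌊ subᵗ x s t / k ⌋
  subᵗ x s (toℚ t)   = toℚ (subᵗ x s t)
  subᵗˢ x s []       = []
  subᵗˢ x s (t ∷ ts) = subᵗ x s t ∷ subᵗˢ x s ts

  subᵃ : ∀ {σ} → Sym [] σ → Term σ → Atom → Atom
  subᵃ x s (prop t) = prop (subᵗ x s t)
  subᵃ x s (t ≈ u)  = subᵗ x s t ≈ subᵗ x s u
  subᵃ x s (t ≼ u)  = subᵗ x s t ≼ subᵗ x s u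

  _[_≔_] : ∀ {σ} → Formula → Sym [] σ → Term σ → Formula
  ⊤ᶠ       [ x ≔ s ] = ⊤ᶠ
  ⊥ᶠ       [ x ≔ s ] = ⊥ᶠ
  atom α   [ x ≔ s ] = atom (subᵃ x s α)
  (¬ᶠ F)   [ x ≔ s ] = ¬ᶠ (F [ x ≔ s ])
  (F ∧ᶠ G) [ x ≔ s ] = (F [ x ≔ s ]) ∧ᶠ (G [ x ≔ s ])
  (F ∨ᶠ G) [ x ≔ s ] = (F [ x ≔ s ]) ∨ᶠ (G [ x ≔ s ])

  Value : (USort → Set) → Srt → Set
  Value U bool      = Bool
  Value U (unint u) = U u
  Value U (arith κ) = Num κ

  -- Carriers are discrete so that satisfaction is decidable, hence classical.
  record Structure : Set₁ where
    field
      Carrier  : USort → Set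
      discrete : ∀ u → DecidableEquality (Carrier u)
      nonempty : ∀ u → Carrier u
      interp   : ∀ {Γ τ} → Sym Γ τ → All (Value Carrier) Γ → Value Carrier τ

  module _ (M : Structure) where
    open Structure M

    ⟦_⟧  : ∀ {σ} → Term σ → Value Carrier σ
    ⟦_⟧ˢ : ∀ {Γ} → All Term Γ → All (Value Carrier) Γ
    ⟦ app f ts ⟧      = interp f ⟦ ts ⟧ˢ
    ⟦ const c ⟧       = c
    ⟦ _⊕_ {κ} s t ⟧   = add κ ⟦ s ⟧ ⟦ t ⟧
    ⟦ _⊙_ {κ} c t ⟧   = mul κ c ⟦ t ⟧
    ⟦ ⌊ t / k ⌋ ⟧     = ⟦ t ⟧ /ℕ k
    ⟦ toℚ t ⟧         = ⟦ t ⟧ ℚ./ 1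
    ⟦ [] ⟧ˢ           = []
    ⟦ t ∷ ts ⟧ˢ       = ⟦ t ⟧ ∷ ⟦ ts ⟧ˢ

    satᵃ : Atom → Set
    satᵃ (prop t)      = ⟦ t ⟧ ≡ true
    satᵃ (s ≈ t)       = ⟦ s ⟧ ≡ ⟦ t ⟧
    satᵃ (_≼_ {κ} s t) = leq κ ⟦ s ⟧ ⟦ t ⟧

    sat : Formula → Set
    sat ⊤ᶠ       = ⊤
    sat ⊥ᶠ       = ⊥
    sat (atom α) = satᵃ α
    sat (¬ᶠ F)   = ¬ sat F
    sat (F ∧ᶠ G) = sat F × sat G
    sat (F ∨ᶠ G) = sat F ⊎ sat G

  infix 1 _⊨_
  _⊨_ : Formula → Formula → Set₁
  F ⊨ G = (M : Structure) → sat M F → sat M G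

  InterpolationProblem : Formula → Formula → Set₁
  InterpolationProblem A B = A ∧ᶠ B ⊨ ⊥ᶠ

  module Locality (A B : Formula) where
    SharedSym ALocalSym BLocalSym : Symbol → Set
    SharedSym f = f ∈ symb A × f ∈ symb B
    ALocalSym f = f ∈ symb A × f ∉ symb B
    BLocalSym f = f ∈ symb B × f ∉ symb A

    -- for a term or literal with the given symbols
    ALocal BLocal Shared Mixed : List Symbol → Set
    ALocal fs = Any ALocalSym fs × ¬ Any BLocalSym fs
    BLocal fs = Any BLocalSym fs × ¬ Any ALocalSym fs
    Shared fs = All SharedSym fs
    Mixed  fs = Any ALocalSym fs × Any BLocalSym fs

  LinComb : Arith → Set
  LinComb κ = List (Num κ × Term (arith κ))

  linear : ∀ {κ} → LinComb κ → Term (arith κ)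
  linear {κ} = foldr (λ (c , t) u → c ⊙ t ⊕ u) (const (0# κ))

  negateLC : ∀ {κ} → LinComb κ → LinComb κ
  negateLC {κ} = map (λ (c , t) → negate κ c , t)

  -- below q is the bound q - ε, with ε infinitesimal, of a strict inequality.
  data Bound : Arith → Set where
    exact : ∀ {κ} → Num κ → Bound κ
    below : ℚ → Bound rat

  _≼ᵇ_ : ∀ {κ} → Term (arith κ) → Bound κ → Formula
  t ≼ᵇ exact c = atom (t ≼ const c)
  t ≼ᵇ below q = ¬ᶠ atom (const q ≼ t)

  -- ¬ (t ≤ c) is equivalent to - t ≤ negateBound c.
  negateBound : ∀ {κ} → Bound κ → Bound κ
  negateBound {int} (exact z) = exact (ℤ.- z ℤ.- 1ℤ)
  negateBound {rat} (exact q) = below (ℚ.- q)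
  negateBound {rat} (below q) = exact (ℚ.- q)

  -- The literals that have projections.  A mixed inequality a + b ≤ c is split
  -- into its A-local part a and the remainder b.
  data ProofLiteral : Set where
    aLocal bLocal shared : Literal → ProofLiteral
    mixedEq mixedNeq     : ∀ {σ} (a b : Term σ) → ProofLiteral
    mixedLeq             : ∀ {κ} (a b : LinComb κ) (c : Bound κ) → ProofLiteral

  Clause : Set
  Clause = List ProofLiteral

  negation : ProofLiteral → ProofLiteral
  negation (aLocal ℓ)       = aLocal (flip ℓ)
  negation (bLocal ℓ)       = bLocal (flip ℓ)
  negation (shared ℓ)       = shared (flip ℓ)
  negation (mixedEq a b)    = mixedNeq a b
  negation (mixedNeq a b)   = mixedEq a b
  negation (mixedLeq a b c) = mixedLeq (negateLC a) (negateLC b) (negateBound c)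

  symbᵖ : ProofLiteral → List Symbol
  symbᵖ (aLocal ℓ)       = symbˡ ℓ
  symbᵖ (bLocal ℓ)       = symbˡ ℓ
  symbᵖ (shared ℓ)       = symbˡ ℓ
  symbᵖ (mixedEq a b)    = symbᵗ a ++ symbᵗ b
  symbᵖ (mixedNeq a b)   = symbᵗ a ++ symbᵗ b
  symbᵖ (mixedLeq a b c) = symbᵗ (linear a) ++ symbᵗ (linear b)

  symbᶜ : Clause → List Symbol
  symbᶜ = concatMap symbᵖ

  module _ (A B : Formula) where
    open Locality A B

    WellClassified : ProofLiteral → Set
    WellClassified (aLocal ℓ)       = ALocal (symbˡ ℓ)
    WellClassified (bLocal ℓ)       = BLocal (symbˡ ℓ)
    WellClassified (shared ℓ)       = Shared (symbˡ ℓ)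
    WellClassified (mixedEq a b)    = ALocal (symbᵗ a) × BLocal (symbᵗ b)
    WellClassified (mixedNeq a b)   = ALocal (symbᵗ a) × BLocal (symbᵗ b)
    WellClassified (mixedLeq a b c) =
      Mixed (symbᵖ (mixedLeq a b c)) ×
      All (λ (_ , t) → ALocal (symbᵗ t)) a ×
      All (λ (_ , t) → BLocal (symbᵗ t) ⊎ Shared (symbᵗ t)) b

  -- An equality and its negation have the same auxiliary variable; an
  -- inequality and its negation have different ones.
  data AuxName : Srt → Set where
    eqVar  : ∀ {σ} (a b : Term σ) → AuxName σ
    eqProp : ∀ {σ} (a b : Term σ) → AuxName bool
    leqVar : ∀ {κ} (a b : LinComb κ) (c : Bound κ) → AuxName (arith κ)

  record AuxVars : Set where
    field
      var       : ∀ {σ} → AuxName σ → Sym [] σ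
      injective : ∀ {σ τ} {m : AuxName σ} {n : AuxName τ} →
                  symbol (var m) ≡ symbol (var n) → (σ , m) ≡ (τ , n)

  EQ : ∀ {σ} → Sym [] bool → Sym [] σ → Term σ → Formula
  EQ p x s = atom (prop (app p [])) xor atom (app x [] ≈ s)

  data SharedProjection : Set where
    pudlák mcmillan : SharedProjection

  shared↓A : SharedProjection → Literal → Formula
  shared↓A pudlák   ℓ = literal ℓ
  shared↓A mcmillan ℓ = ⊤ᶠ

  Fresh : AuxVars → List Symbol → Set
  Fresh V fs = ∀ {σ} (n : AuxName σ) → symbol (AuxVars.var V n) ∉ fs

  module _ (V : AuxVars) (mode : SharedProjection) where
    open AuxVars V

    _↓A _↓B : ProofLiteral → Formula

    aLocal ℓ       ↓A = literal ℓ
    bLocal ℓ       ↓A = ⊤ᶠ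
    shared ℓ       ↓A = shared↓A mode ℓ
    mixedEq a b    ↓A = atom (a ≈ app (var (eqVar a b)) [])
    mixedNeq a b   ↓A = atom (prop (app (var (eqProp a b)) []))
                        xor atom (a ≈ app (var (eqVar a b)) [])
    mixedLeq {κ} a b c ↓A =
      linear a ⊕ app (var (leqVar a b c)) [] ≼ᵇ exact (0# κ)

    aLocal ℓ       ↓B = ⊤ᶠ
    bLocal ℓ       ↓B = literal ℓ
    shared ℓ       ↓B = literal ℓ
    mixedEq a b    ↓B = atom (app (var (eqVar a b)) [] ≈ b)
    mixedNeq a b   ↓B = (¬ᶠ atom (prop (app (var (eqProp a b)) [])))
                        xor atom (app (var (eqVar a b)) [] ≈ b)
    mixedLeq {κ} a b c ↓B =
      -1# κ ⊙ app (var (leqVar a b c)) [] ⊕ linear b ≼ᵇ c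

    -- introduced by the projections of a literal
    aux : ProofLiteral → List Symbol
    aux (aLocal ℓ)       = []
    aux (bLocal ℓ)       = []
    aux (shared ℓ)       = []
    aux (mixedEq a b)    = symbol (var (eqVar a b)) ∷ []
    aux (mixedNeq a b)   = symbol (var (eqVar a b)) ∷ symbol (var (eqProp a b)) ∷ []
    aux (mixedLeq a b c) = symbol (var (leqVar a b c)) ∷ []

    -- the projections of ¬C, for a clause C
    ¬_⇂A ¬_⇂B : Clause → Formula
    ¬ C ⇂A = ⋀ (map (λ ℓ → negation ℓ ↓A) C)
    ¬ C ⇂B = ⋀ (map (λ ℓ → negation ℓ ↓B) C)

    record PartialInterpolant (A B : Formula) (C : Clause) (I : Formula) : Set₁ where
      open Locality A B
      field
        implied      : A ∧ᶠ (¬ C ⇂A) ⊨ I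
        inconsistent : B ∧ᶠ (¬ C ⇂B) ∧ᶠ I ⊨ ⊥ᶠ
        symbols      : ∀ {f} → f ∈ symb I →
                       SharedSym f ⊎ f ∈ concatMap (λ ℓ → aux (negation ℓ)) C

{-# OPTIONS --safe #-}
module Submission where

-- Write x and p for the two auxiliary variables of a = b.  They occur in
-- neither A, B, a, b nor the projections of ¬ C₁ and ¬ C₂, and not in the new
-- formula I₁[I₂(s₁)]…[I₂(sₙ)] either.  So the values of x and p in a model
-- may be changed at will without affecting any of these (coincidence lemma,
-- sat-update₂), and they are chosen so that x separates a from b.
--
-- Implied by A: set x to the value of a and p to false.  Both given partial
-- interpolants apply, so I₁[EQ(x,s₁)]…[EQ(x,sₙ)] and I₂(x) hold, and
-- EQ(x,sᵢ) now says x = sᵢ.  Hence EQ(x,sᵢ) implies I₂(sᵢ) (substitution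
-- lemma, sat-sub), and since the EQ(x,sᵢ) occur only positively (plug-mono),
-- the new formula holds.
--
-- Inconsistent with B: set x to the value of b and p to true.  Now I₂(x) fails,
-- and EQ(x,sᵢ) says x ≠ sᵢ.  Hence I₂(sᵢ) implies EQ(x,sᵢ), so that the new
-- formula implies I₁[EQ(x,s₁)]…[EQ(x,sₙ)], which is inconsistent with B.
--
-- Symbols: the new formula contains only symbols of the two given formulae,
-- and neither x nor p (symb-plug, symb-sub).

open import Data.Bool.Base using (true; false)
open import Data.Empty using (⊥-elim)
open import Data.Fin.Base using (Fin)
open import Data.Integer.DivMod using (_/ℕ_)
open import Data.List.Base using (List; []; _∷_; _++_; map; concatMap)
open import Data.List.Membership.Propositional using (_∈_; _∉_)
open import Data.List.Membership.Propositional.Properties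
  using (∈-++⁺ˡ; ∈-++⁺ʳ; ∈-++⁻)
open import Data.List.Relation.Unary.All using (All; []; _∷_)
open import Data.List.Relation.Unary.Any using (here; there)
open import Data.Nat.Base using (ℕ)
open import Data.Product.Base using (_×_; _,_; proj₁; proj₂)
import Data.Rational.Base as ℚ
open import Data.Sum.Base using (_⊎_; inj₁; inj₂; [_,_]′)
import Data.Sum.Base as Sum
open import Function.Base using (_∘_; id)
open import Relation.Binary.PropositionalEquality
  using (_≡_; _≢_; refl; sym; trans; cong; cong₂; subst)
open import Relation.Nullary using (¬_; Dec; yes; no)
open import Defs

-- Membership in lists

module _ {a} {X : Set a} where

  ∉-++ˡ : ∀ {v : X} {xs ys} → v ∉ xs ++ ys → v ∉ xs
  ∉-++ˡ v∉ = v∉ ∘ ∈-++⁺ˡ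

  ∉-++ʳ : ∀ {v : X} xs {ys} → v ∉ xs ++ ys → v ∉ ys
  ∉-++ʳ xs v∉ = v∉ ∘ ∈-++⁺ʳ xs

  ∈-++-elim : ∀ {p} {P : Set p} {v : X} xs {ys} → (v ∈ xs → P) → (v ∈ ys → P) →
              v ∈ xs ++ ys → P
  ∈-++-elim xs f g = [ f , g ]′ ∘ ∈-++⁻ xs

  ∈-++-map : ∀ {v : X} {P : Set a} {xs ys xs′ ys′ : List X} →
             (v ∈ xs → v ∈ xs′ ⊎ P) → (v ∈ ys → v ∈ ys′ ⊎ P) →
             v ∈ xs ++ ys → v ∈ xs′ ++ ys′ ⊎ P
  ∈-++-map {xs = xs} {xs′ = xs′} f g v∈ with ∈-++⁻ xs v∈
  ... | inj₁ v∈xs = Sum.map₁ ∈-++⁺ˡ (f v∈xs)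
  ... | inj₂ v∈ys = Sum.map₁ (∈-++⁺ʳ xs′) (g v∈ys)

module _ {a b} {X : Set a} {Y : Set b} (h : X → List Y) where

  ∈-concatMap⁺ˡ : ∀ {v} xs {ys} → v ∈ concatMap h xs → v ∈ concatMap h (xs ++ ys)
  ∈-concatMap⁺ˡ (x ∷ xs) v∈ with ∈-++⁻ (h x) v∈
  ... | inj₁ v∈x  = ∈-++⁺ˡ v∈x
  ... | inj₂ v∈xs = ∈-++⁺ʳ (h x) (∈-concatMap⁺ˡ xs v∈xs)

  ∈-concatMap⁺ʳ : ∀ {v} xs {ys} → v ∈ concatMap h ys → v ∈ concatMap h (xs ++ ys)
  ∈-concatMap⁺ʳ []       v∈ = v∈
  ∈-concatMap⁺ʳ (x ∷ xs) v∈ = ∈-++⁺ʳ (h x) (∈-concatMap⁺ʳ xs v∈)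

module _ {S : Signature} where
  open Signature S
  open Structure

  -- Changing the interpretation of a nullary symbol

  -- The new interpretation of f when x is given the value v and w is what f had
  -- before.
  reinterpret : ∀ {U : USort → Set} {Γ σ τ} {f : Sym Γ τ} {x : Sym [] σ} →
                Dec (symbol {S} f ≡ symbol {S} x) →
                Value {S} U σ → Value {S} U τ → Value {S} U τ
  reinterpret (yes refl) v w = v
  reinterpret (no _)     v w = w

  infixl 8 _[_↦_]

  -- The structure M, except that the nullary symbol x has the value v.
  _[_↦_] : ∀ {σ} (M : Structure {S}) → Sym [] σ → Value {S} (Carrier M) σ →
           Structure {S}
  (M [ x ↦ v ]) .Carrier       = Carrier M
  (M [ x ↦ v ]) .discrete      = discrete M
  (M [ x ↦ v ]) .nonempty      = nonempty M
  (M [ x ↦ v ]) .interp f vs   =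
    reinterpret {U = Carrier M} (symbol {S} f ≟ symbol {S} x) v (interp M f vs)

  value-updated : ∀ {σ} (M : Structure {S}) (x : Sym [] σ) v →
                  ⟦_⟧ (M [ x ↦ v ]) (app x []) ≡ v
  value-updated M x v with symbol {S} x ≟ symbol {S} x
  ... | yes refl = refl
  ... | no x≢x   = ⊥-elim (x≢x refl)

  -- Coincidence lemma: a symbol that does not occur does not matter.
  module _ {σ} (M : Structure {S}) (x : Sym [] σ) (v : Value {S} (Carrier M) σ) where
    private M′ = M [ x ↦ v ]

    eval-update  : ∀ {τ} (t : Term {S} τ) → symbol {S} x ∉ symbᵗ t →
                   ⟦_⟧ M′ t ≡ ⟦_⟧ M t
    eval-updateˢ : ∀ {Γ} (ts : All (Term {S}) Γ) → symbol {S} x ∉ symbᵗˢ ts →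
                   ⟦_⟧ˢ M′ ts ≡ ⟦_⟧ˢ M ts
    eval-update (app f ts) x∉ with symbol {S} f ≟ symbol {S} x
    ... | yes refl = ⊥-elim (x∉ (here refl))
    ... | no _     = cong (interp M f) (eval-updateˢ ts (x∉ ∘ there))
    eval-update (const c) x∉     = refl
    eval-update (_⊕_ {κ} s t) x∉ =
      cong₂ (add κ) (eval-update s (∉-++ˡ x∉)) (eval-update t (∉-++ʳ (symbᵗ s) x∉))
    eval-update (_⊙_ {κ} c t) x∉ = cong (mul κ c) (eval-update t x∉)
    eval-update ⌊ t / k ⌋ x∉     = cong (_/ℕ k) (eval-update t x∉)
    eval-update (toℚ t) x∉       = cong (ℚ._/ 1) (eval-update t x∉)
    eval-updateˢ [] x∉           = refl
    eval-updateˢ (t ∷ ts) x∉     =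
      cong₂ _∷_ (eval-update t (∉-++ˡ x∉)) (eval-updateˢ ts (∉-++ʳ (symbᵗ t) x∉))

    sat-updateᵃ : (α : Atom {S}) → symbol {S} x ∉ symbᵃ α → satᵃ M′ α ≡ satᵃ M α
    sat-updateᵃ (prop t) x∉      = cong (_≡ true) (eval-update t x∉)
    sat-updateᵃ (s ≈ t) x∉       =
      cong₂ _≡_ (eval-update s (∉-++ˡ x∉)) (eval-update t (∉-++ʳ (symbᵗ s) x∉))
    sat-updateᵃ (_≼_ {κ} s t) x∉ =
      cong₂ (leq κ) (eval-update s (∉-++ˡ x∉)) (eval-update t (∉-++ʳ (symbᵗ s) x∉))

    sat-update : (F : Formula {S}) → symbol {S} x ∉ symb F → sat M′ F ≡ sat M F
    sat-update ⊤ᶠ x∉       = refl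
    sat-update ⊥ᶠ x∉       = refl
    sat-update (atom α) x∉ = sat-updateᵃ α x∉
    sat-update (¬ᶠ F) x∉   = cong ¬_ (sat-update F x∉)
    sat-update (F ∧ᶠ G) x∉ =
      cong₂ _×_ (sat-update F (∉-++ˡ x∉)) (sat-update G (∉-++ʳ (symb F) x∉))
    sat-update (F ∨ᶠ G) x∉ =
      cong₂ _⊎_ (sat-update F (∉-++ˡ x∉)) (sat-update G (∉-++ʳ (symb F) x∉))

  module _ {σ τ} (M : Structure {S}) (x : Sym [] σ) (v : Value {S} (Carrier M) σ)
           (y : Sym [] τ) (w : Value {S} (Carrier M) τ) where

    eval-update₂ : ∀ {ρ} (t : Term {S} ρ) → symbol {S} x ∉ symbᵗ t → symbol {S} y ∉ symbᵗ t →
                   ⟦_⟧ (M [ x ↦ v ] [ y ↦ w ]) t ≡ ⟦_⟧ M t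
    eval-update₂ t x∉ y∉ =
      trans (eval-update (M [ x ↦ v ]) y w t y∉) (eval-update M x v t x∉)

    sat-update₂ : (F : Formula {S}) → symbol {S} x ∉ symb F → symbol {S} y ∉ symb F →
                  sat (M [ x ↦ v ] [ y ↦ w ]) F ≡ sat M F
    sat-update₂ F x∉ y∉ =
      trans (sat-update (M [ x ↦ v ]) y w F y∉) (sat-update M x v F x∉)

  -- Substitution

  -- Substitution lemma: if x and s have equal values, then substituting s for x
  -- changes neither values nor truth.
  module _ {σ} (M : Structure {S}) (x : Sym [] σ) (s : Term {S} σ)
           (x≡s : ⟦_⟧ M (app x []) ≡ ⟦_⟧ M s) where

    eval-sub  : ∀ {τ} (t : Term {S} τ) → ⟦_⟧ M (subᵗ x s t) ≡ ⟦_⟧ M t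
    eval-subˢ : ∀ {Γ} (ts : All (Term {S}) Γ) → ⟦_⟧ˢ M (subᵗˢ x s ts) ≡ ⟦_⟧ˢ M ts
    eval-sub (app f ts) with symbol {S} f ≟ symbol {S} x
    eval-sub (app f []) | yes refl = sym x≡s
    ... | no _            = cong (interp M f) (eval-subˢ ts)
    eval-sub (const c)     = refl
    eval-sub (_⊕_ {κ} t u) = cong₂ (add κ) (eval-sub t) (eval-sub u)
    eval-sub (_⊙_ {κ} c t) = cong (mul κ c) (eval-sub t)
    eval-sub ⌊ t / k ⌋     = cong (_/ℕ k) (eval-sub t)
    eval-sub (toℚ t)       = cong (ℚ._/ 1) (eval-sub t)
    eval-subˢ []           = refl
    eval-subˢ (t ∷ ts)     = cong₂ _∷_ (eval-sub t) (eval-subˢ ts)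

    sat-subᵃ : (α : Atom {S}) → satᵃ M (subᵃ x s α) ≡ satᵃ M α
    sat-subᵃ (prop t)      = cong (_≡ true) (eval-sub t)
    sat-subᵃ (t ≈ u)       = cong₂ _≡_ (eval-sub t) (eval-sub u)
    sat-subᵃ (_≼_ {κ} t u) = cong₂ (leq κ) (eval-sub t) (eval-sub u)

    sat-sub : (F : Formula {S}) → sat M (F [ x ≔ s ]) ≡ sat M F
    sat-sub ⊤ᶠ       = refl
    sat-sub ⊥ᶠ       = refl
    sat-sub (atom α) = sat-subᵃ α
    sat-sub (¬ᶠ F)   = cong ¬_ (sat-sub F)
    sat-sub (F ∧ᶠ G) = cong₂ _×_ (sat-sub F) (sat-sub G)
    sat-sub (F ∨ᶠ G) = cong₂ _⊎_ (sat-sub F) (sat-sub G)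

  -- A symbol of F[x ≔ s] is a symbol of F other than x, or a symbol of s.
  module _ {σ} (x : Sym [] σ) (s : Term {S} σ) {f : Symbol {S}} where

    OldOrNew : List (Symbol {S}) → Set
    OldOrNew fs = (f ∈ fs × f ≢ symbol {S} x) ⊎ f ∈ symbᵗ s

    oldOrNew-++ : ∀ {fs′ gs′} fs {gs} →
                  (f ∈ fs′ → OldOrNew fs) → (f ∈ gs′ → OldOrNew gs) →
                  f ∈ fs′ ++ gs′ → OldOrNew (fs ++ gs)
    oldOrNew-++ {fs′} fs h k f∈ with ∈-++⁻ fs′ f∈
    ... | inj₁ f∈fs′ = Sum.map₁ (λ (f∈fs , f≢x) → ∈-++⁺ˡ f∈fs , f≢x) (h f∈fs′)
    ... | inj₂ f∈gs′ = Sum.map₁ (λ (f∈gs , f≢x) → ∈-++⁺ʳ fs f∈gs , f≢x) (k f∈gs′)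

    symb-subᵗ  : ∀ {τ} (t : Term {S} τ) → f ∈ symbᵗ (subᵗ x s t) → OldOrNew (symbᵗ t)
    symb-subᵗˢ : ∀ {Γ} (ts : All (Term {S}) Γ) →
                 f ∈ symbᵗˢ (subᵗˢ x s ts) → OldOrNew (symbᵗˢ ts)
    symb-subᵗ (app g ts) f∈ with symbol {S} g ≟ symbol {S} x
    symb-subᵗ (app g ts) f∈          | yes refl = inj₂ f∈
    symb-subᵗ (app g ts) (here refl) | no g≢x   = inj₁ (here refl , g≢x)
    symb-subᵗ (app g ts) (there f∈)  | no _     =
      Sum.map₁ (λ (f∈ts , f≢x) → there f∈ts , f≢x) (symb-subᵗˢ ts f∈)
    symb-subᵗ (t ⊕ u)           = oldOrNew-++ (symbᵗ t) (symb-subᵗ t) (symb-subᵗ u)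
    symb-subᵗ (c ⊙ t)           = symb-subᵗ t
    symb-subᵗ ⌊ t / k ⌋         = symb-subᵗ t
    symb-subᵗ (toℚ t)           = symb-subᵗ t
    symb-subᵗˢ (t ∷ ts)         = oldOrNew-++ (symbᵗ t) (symb-subᵗ t) (symb-subᵗˢ ts)

    symb-subᵃ : (α : Atom {S}) → f ∈ symbᵃ (subᵃ x s α) → OldOrNew (symbᵃ α)
    symb-subᵃ (prop t) = symb-subᵗ t
    symb-subᵃ (t ≈ u)  = oldOrNew-++ (symbᵗ t) (symb-subᵗ t) (symb-subᵗ u)
    symb-subᵃ (t ≼ u)  = oldOrNew-++ (symbᵗ t) (symb-subᵗ t) (symb-subᵗ u)

    symb-sub : (F : Formula {S}) → f ∈ symb (F [ x ≔ s ]) → OldOrNew (symb F)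
    symb-sub (atom α) = symb-subᵃ α
    symb-sub (¬ᶠ F)   = symb-sub F
    symb-sub (F ∧ᶠ G) = oldOrNew-++ (symb F) (symb-sub F) (symb-sub G)
    symb-sub (F ∨ᶠ G) = oldOrNew-++ (symb F) (symb-sub F) (symb-sub G)

  -- Placeholders

  plug-mono : ∀ (M : Structure {S}) {n} (E : NNF {S} n) {G H : Fin n → Formula {S}} →
              (∀ i → sat M (G i) → sat M (H i)) → sat M (plug E G) → sat M (plug E H)
  plug-mono M ⊤ⁿ       h s        = s
  plug-mono M (lit ℓ)  h s        = s
  plug-mono M (hole i) h s        = h i s
  plug-mono M (E ∧ⁿ F) h (s , t)  = plug-mono M E h s , plug-mono M F h t
  plug-mono M (E ∨ⁿ F) h (inj₁ s) = inj₁ (plug-mono M E h s)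
  plug-mono M (E ∨ⁿ F) h (inj₂ t) = inj₂ (plug-mono M F h t)

  -- Replacing each G i by H i loses the symbol f only if P holds.  Taking
  -- H i = ⊤ᶠ bounds the symbols of plug E G by those of E and of the G i
  -- (∉-plug).
  symb-plug : ∀ {f : Symbol {S}} {P : Set} {n} (E : NNF {S} n) (G H : Fin n → Formula {S}) →
              (∀ i → f ∈ symb (G i) → f ∈ symb (H i) ⊎ P) →
              f ∈ symb (plug E G) → f ∈ symb (plug E H) ⊎ P
  symb-plug (lit ℓ)  G H h f∈ = inj₁ f∈
  symb-plug (hole i) G H h f∈ = h i f∈
  symb-plug (E ∧ⁿ F) G H h    = ∈-++-map (symb-plug E G H h) (symb-plug F G H h)
  symb-plug (E ∨ⁿ F) G H h    = ∈-++-map (symb-plug E G H h) (symb-plug F G H h)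

  ∉-plug : ∀ {f : Symbol {S}} {n} (E : NNF {S} n) (G : Fin n → Formula {S}) →
           f ∉ symbⁿ E → (∀ i → f ∉ symb (G i)) → f ∉ symb (plug E G)
  ∉-plug E G f∉E f∉G f∈ =
    [ f∉E , id ]′ (symb-plug E G (λ _ → ⊤ᶠ) (λ i f∈Gi → ⊥-elim (f∉G i f∈Gi)) f∈)

  -- Symbols of the projections

  symbˡ-flip : ∀ {f : Symbol {S}} (ℓ : Literal {S}) → f ∈ symbˡ (flip ℓ) → f ∈ symbˡ ℓ
  symbˡ-flip (pos α) f∈ = f∈
  symbˡ-flip (neg α) f∈ = f∈

  symb-negateLC : ∀ {κ} (a : LinComb {S} κ) → symbᵗ (linear (negateLC a)) ≡ symbᵗ (linear a)
  symb-negateLC []            = refl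
  symb-negateLC ((c , t) ∷ a) = cong (symbᵗ t ++_) (symb-negateLC a)

  symbᵖ-negation : ∀ {f : Symbol {S}} (ℓ : ProofLiteral {S}) →
                   f ∈ symbᵖ (negation ℓ) → f ∈ symbᵖ ℓ
  symbᵖ-negation (aLocal ℓ)             = symbˡ-flip ℓ
  symbᵖ-negation (bLocal ℓ)             = symbˡ-flip ℓ
  symbᵖ-negation (shared ℓ)             = symbˡ-flip ℓ
  symbᵖ-negation (mixedEq a b)          = id
  symbᵖ-negation (mixedNeq a b)         = id
  symbᵖ-negation {f} (mixedLeq a b c) =
    subst (f ∈_) (cong₂ _++_ (symb-negateLC a) (symb-negateLC b))

  symb-≼ᵇ : ∀ {f : Symbol {S}} {κ} (t : Term {S} (arith κ)) (c : Bound {S} κ) →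
            f ∈ symb (t ≼ᵇ c) → f ∈ symbᵗ t
  symb-≼ᵇ t (exact c) f∈ with ∈-++⁻ (symbᵗ t) f∈
  ... | inj₁ f∈t = f∈t
  symb-≼ᵇ t (below q) f∈ = f∈

  ∈-xor : ∀ {f : Symbol {S}} {P : Set} (F G : Formula {S}) →
          (f ∈ symb F → P) → (f ∈ symb G → P) → f ∈ symb (F xor G) → P
  ∈-xor F G h k = ∈-++-elim (symb F ++ symb G) hk hk
    where hk = ∈-++-elim (symb F) h k

  sat-⋀-++ : ∀ (M : Structure {S}) (g : ProofLiteral {S} → Formula {S}) C₁ {C₂} →
             sat M (⋀ (map g (C₁ ++ C₂))) → sat M (⋀ (map g C₁)) × sat M (⋀ (map g C₂))
  sat-⋀-++ M g []       s       = _ , s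
  sat-⋀-++ M g (ℓ ∷ C₁) (s , t) =
    let t₁ , t₂ = sat-⋀-++ M g C₁ t in (s , t₁) , t₂

  module _ (V : AuxVars {S}) (mode : SharedProjection {S}) where
    open AuxVars V

    -- The auxiliary variables introduced for the negation of a clause.
    auxᶜ : Clause {S} → List (Symbol {S})
    auxᶜ = concatMap (λ ℓ → aux V mode (negation ℓ))

    symb-↓A : ∀ {f} (ℓ : ProofLiteral {S}) →
              f ∈ symb (_↓A V mode ℓ) → f ∈ symbᵖ ℓ ⊎ f ∈ aux V mode ℓ
    symb-↓A (aLocal ℓ) = inj₁
    symb-↓A (shared ℓ) = inj₁ ∘ symb-shared mode
      where
      symb-shared : ∀ m {f} → f ∈ symb (shared↓A m ℓ) → f ∈ symbˡ ℓ
      symb-shared pudlák = id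
    symb-↓A (mixedEq a b) = ∈-++-elim (symbᵗ a) (inj₁ ∘ ∈-++⁺ˡ) inj₂
    symb-↓A (mixedNeq a b) =
      ∈-xor (atom (prop (app (var (eqProp a b)) [])))
            (atom (a ≈ app (var (eqVar a b)) []))
            (inj₂ ∘ there) (∈-++-elim (symbᵗ a) (inj₁ ∘ ∈-++⁺ˡ) (inj₂ ∘ ∈-++⁺ˡ))
    symb-↓A (mixedLeq {κ} a b c) =
      ∈-++-elim (symbᵗ (linear a)) (inj₁ ∘ ∈-++⁺ˡ) inj₂
      ∘ symb-≼ᵇ (linear a ⊕ app (var (leqVar a b c)) []) (exact (0# κ))

    symb-↓B : ∀ {f} (ℓ : ProofLiteral {S}) →
              f ∈ symb (_↓B V mode ℓ) → f ∈ symbᵖ ℓ ⊎ f ∈ aux V mode ℓ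
    symb-↓B (bLocal ℓ) = inj₁
    symb-↓B (shared ℓ) = inj₁
    symb-↓B (mixedEq a b) =
      ∈-++-elim (symbol {S} (var (eqVar a b)) ∷ []) inj₂ (inj₁ ∘ ∈-++⁺ʳ (symbᵗ a))
    symb-↓B (mixedNeq a b) =
      ∈-xor (¬ᶠ atom (prop (app (var (eqProp a b)) [])))
            (atom (app (var (eqVar a b)) [] ≈ b))
            (inj₂ ∘ there)
            (∈-++-elim (symbol {S} (var (eqVar a b)) ∷ []) (inj₂ ∘ ∈-++⁺ˡ)
              (inj₁ ∘ ∈-++⁺ʳ (symbᵗ a)))
    symb-↓B (mixedLeq {κ} a b c) =
      ∈-++-elim (symbol {S} (var (leqVar a b c)) ∷ []) inj₂ (inj₁ ∘ ∈-++⁺ʳ (symbᵗ (linear a)))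
      ∘ symb-≼ᵇ (-1# κ ⊙ app (var (leqVar a b c)) [] ⊕ linear b) c

    -- Stated for an arbitrary projection g, to be used for both.
    ∉-¬⇂ : ∀ {f} (g : ProofLiteral {S} → Formula {S}) →
           (∀ ℓ → f ∈ symb (g ℓ) → f ∈ symbᵖ ℓ ⊎ f ∈ aux V mode ℓ) →
           ∀ C → f ∉ symbᶜ C → f ∉ auxᶜ C →
           f ∉ symb (⋀ (map (λ ℓ → g (negation ℓ)) C))
    ∉-¬⇂ g h (ℓ ∷ C) f∉C f∉aux =
      ∈-++-elim (symb (g (negation ℓ)))
        ([ ∉-++ˡ f∉C ∘ symbᵖ-negation ℓ , ∉-++ˡ f∉aux ]′ ∘ h (negation ℓ))
        (∉-¬⇂ g h C (∉-++ʳ (symbᵖ ℓ) f∉C) (∉-++ʳ (aux V mode (negation ℓ)) f∉aux))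

    -- Each auxiliary variable of a = b comes from the literals of that atom only,
    -- and p = var (eqProp a b) only from the negation of a = b.

    eqVar∈aux : ∀ {σ} {a b : Term {S} σ} (ℓ : ProofLiteral {S}) →
                symbol {S} (var (eqVar a b)) ∈ aux V mode (negation ℓ) →
                mixedEq a b ≡ ℓ ⊎ mixedNeq a b ≡ ℓ
    eqVar∈aux {a = a} {b} (mixedEq c d) (here eq)
      with refl ← injective {m = eqVar a b} {n = eqVar c d} eq = inj₁ refl
    eqVar∈aux {a = a} {b} (mixedEq c d) (there (here eq))
      with () ← injective {m = eqVar a b} {n = eqProp c d} eq
    eqVar∈aux {a = a} {b} (mixedNeq c d) (here eq)
      with refl ← injective {m = eqVar a b} {n = eqVar c d} eq = inj₂ refl
    eqVar∈aux {a = a} {b} (mixedLeq c d e) (here eq)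
      with () ← injective {m = eqVar a b} {n = leqVar (negateLC c) (negateLC d) (negateBound e)} eq

    eqProp∈aux : ∀ {σ} {a b : Term {S} σ} (ℓ : ProofLiteral {S}) →
                 symbol {S} (var (eqProp a b)) ∈ aux V mode (negation ℓ) → mixedEq a b ≡ ℓ
    eqProp∈aux {a = a} {b} (mixedEq c d) (here eq)
      with () ← injective {m = eqProp a b} {n = eqVar c d} eq
    eqProp∈aux {a = a} {b} (mixedEq c d) (there (here eq))
      with refl ← injective {m = eqProp a b} {n = eqProp c d} eq = refl
    eqProp∈aux {a = a} {b} (mixedNeq c d) (here eq)
      with () ← injective {m = eqProp a b} {n = eqVar c d} eq
    eqProp∈aux {a = a} {b} (mixedLeq c d e) (here eq)
      with () ← injective {m = eqProp a b} {n = leqVar (negateLC c) (negateLC d) (negateBound e)} eq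

    eqVar∉auxᶜ : ∀ {σ} {a b : Term {S} σ} (C : Clause {S}) →
                 mixedEq a b ∉ C → mixedNeq a b ∉ C → symbol {S} (var (eqVar a b)) ∉ auxᶜ C
    eqVar∉auxᶜ (ℓ ∷ C) eq∉ neq∉ =
      ∈-++-elim (aux V mode (negation ℓ))
        ([ eq∉ ∘ here , neq∉ ∘ here ]′ ∘ eqVar∈aux ℓ)
        (eqVar∉auxᶜ C (eq∉ ∘ there) (neq∉ ∘ there))

    eqProp∉auxᶜ : ∀ {σ} {a b : Term {S} σ} (C : Clause {S}) →
                  mixedEq a b ∉ C → symbol {S} (var (eqProp a b)) ∉ auxᶜ C
    eqProp∉auxᶜ (ℓ ∷ C) eq∉ =
      ∈-++-elim (aux V mode (negation ℓ))
        (eq∉ ∘ here ∘ eqProp∈aux ℓ)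
        (eqProp∉auxᶜ C (eq∉ ∘ there))

-- Resolution on a mixed equality

theorem2 : (S : Signature) (V : AuxVars {S}) (mode : SharedProjection)
    (A B : Formula) → InterpolationProblem A B →
    {σ : Srt {S}} (a b : Term {S} σ) (C₁ C₂ : Clause) →
    let x = AuxVars.var V (eqVar a b) in
    let p = AuxVars.var V (eqProp a b) in
    All (WellClassified A B) (mixedEq a b ∷ C₁) →
    All (WellClassified A B) (mixedNeq a b ∷ C₂) →
    mixedEq a b ∉ C₁ → mixedNeq a b ∉ C₁ →
    mixedEq a b ∉ C₂ → mixedNeq a b ∉ C₂ →
    Fresh V (symb A) → Fresh V (symb B) →
    Fresh V (symbᶜ (mixedEq a b ∷ C₁)) → Fresh V (symbᶜ (mixedNeq a b ∷ C₂)) →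
    {n : ℕ} (I₁ : NNF n) (s : Fin n → Term σ) →
    symbol {S} x ∉ symbⁿ I₁ → symbol {S} p ∉ symbⁿ I₁ →
    (∀ i → symbol {S} x ∉ symbᵗ (s i)) → (∀ i → symbol {S} p ∉ symbᵗ (s i)) →
    PartialInterpolant V mode A B (mixedEq a b ∷ C₁) (plug I₁ (λ i → EQ p x (s i))) →
    (I₂ : Formula) →
    PartialInterpolant V mode A B (mixedNeq a b ∷ C₂) I₂ →
    PartialInterpolant V mode A B (C₁ ++ C₂) (plug I₁ (λ i → I₂ [ x ≔ s i ]))
theorem2 S V mode A B _ {σ} a b C₁ C₂ _ _ eq∉C₁ neq∉C₁ eq∉C₂ neq∉C₂
         freshA freshB freshC₁ freshC₂ I₁ s x∉I₁ p∉I₁ x∉s p∉s pi₁ I₂ pi₂ =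
  record { implied = implied′ ; inconsistent = inconsistent′ ; symbols = symbols′ }
  where
  open AuxVars V
  open Locality A B
  module PI₁ = PartialInterpolant pi₁
  module PI₂ = PartialInterpolant pi₂

  x = var (eqVar a b)
  p = var (eqProp a b)

  -- The new formula.
  J : Formula {S}
  J = plug I₁ (λ i → I₂ [ x ≔ s i ])

  p∉x : symbol {S} p ∉ symbol {S} x ∷ []
  p∉x (here eq) with () ← injective {m = eqProp a b} {n = eqVar a b} eq

  -- Contains neither auxiliary variable of a = b.
  Absent : List (Symbol {S}) → Set
  Absent fs = symbol {S} x ∉ fs × symbol {S} p ∉ fs

  x∉aux₁ : symbol {S} x ∉ auxᶜ V mode C₁
  x∉aux₁ = eqVar∉auxᶜ V mode C₁ eq∉C₁ neq∉C₁

  p∉aux₁ : symbol {S} p ∉ auxᶜ V mode C₁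
  p∉aux₁ = eqProp∉auxᶜ V mode C₁ eq∉C₁

  p∉aux₂ : symbol {S} p ∉ auxᶜ V mode C₂
  p∉aux₂ = eqProp∉auxᶜ V mode C₂ eq∉C₂

  absent-a : Absent (symbᵗ a)
  absent-a = ∉-++ˡ (∉-++ˡ (freshC₁ (eqVar a b))) , ∉-++ˡ (∉-++ˡ (freshC₁ (eqProp a b)))

  absent-b : Absent (symbᵗ b)
  absent-b = ∉-++ʳ (symbᵗ a) (∉-++ˡ (freshC₁ (eqVar a b)))
           , ∉-++ʳ (symbᵗ a) (∉-++ˡ (freshC₁ (eqProp a b)))

  -- For either projection g of the two negated clauses.
  module _ (g : ProofLiteral {S} → Formula {S})
           (h : ∀ {f} ℓ → f ∈ symb (g ℓ) → f ∈ symbᵖ ℓ ⊎ f ∈ aux V mode ℓ) where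

    absent₁ : Absent (symb (⋀ (map (λ ℓ → g (negation ℓ)) C₁)))
    absent₁ = ∉-¬⇂ V mode g h C₁ (∉-++ʳ ab (freshC₁ (eqVar a b))) x∉aux₁
            , ∉-¬⇂ V mode g h C₁ (∉-++ʳ ab (freshC₁ (eqProp a b))) p∉aux₁
      where ab = symbᵗ a ++ symbᵗ b

    absent₂ : Absent (symb (⋀ (map (λ ℓ → g (negation ℓ)) C₂)))
    absent₂ = ∉-¬⇂ V mode g h C₂ (∉-++ʳ ab (freshC₂ (eqVar a b)))
                (eqVar∉auxᶜ V mode C₂ eq∉C₂ neq∉C₂)
            , ∉-¬⇂ V mode g h C₂ (∉-++ʳ ab (freshC₂ (eqProp a b))) p∉aux₂
      where ab = symbᵗ a ++ symbᵗ b

  -- The projections of a ≠ b introduce p, but those of a = b, which is the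
  -- negation of the literal in C₂ ∨ a ≠ b, do not.
  p∉I₂ : symbol {S} p ∉ symb I₂
  p∉I₂ p∈I₂ with PI₂.symbols p∈I₂
  ... | inj₁ (p∈A , _)    = freshA (eqProp a b) p∈A
  ... | inj₂ (here p≡x)   = p∉x (here p≡x)
  ... | inj₂ (there p∈C₂) = p∉aux₂ p∈C₂

  absent-J : Absent (symb J)
  absent-J =
      ∉-plug I₁ _ x∉I₁ (λ i → [ (λ (_ , x≢x) → x≢x refl) , x∉s i ]′ ∘ symb-sub x (s i) I₂)
    , ∉-plug I₁ _ p∉I₁ (λ i → [ p∉I₂ ∘ proj₁ , p∉s i ]′ ∘ symb-sub x (s i) I₂)

  -- The model in which x and p have been given the values v and w.
  module Update (M : Structure {S}) (v : Value {S} (Structure.Carrier M) σ)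
                (w : Value {S} (Structure.Carrier M) bool) where

    M′ : Structure {S}
    M′ = M [ x ↦ v ] [ p ↦ w ]

    value-x : ⟦_⟧ M′ (app x []) ≡ v
    value-x = trans (eval-update (M [ x ↦ v ]) p w (app x []) p∉x) (value-updated M x v)

    value-p : ⟦_⟧ M′ (app p []) ≡ w
    value-p = value-updated (M [ x ↦ v ]) p w

    value : (t : Term {S} σ) → Absent (symbᵗ t) → ⟦_⟧ M′ t ≡ ⟦_⟧ M t
    value t (x∉t , p∉t) = eval-update₂ M x v p w t x∉t p∉t

    into : (F : Formula {S}) → Absent (symb F) → sat M F → sat M′ F
    into F (x∉F , p∉F) = subst id (sym (sat-update₂ M x v p w F x∉F p∉F))

    outof : (F : Formula {S}) → Absent (symb F) → sat M′ F → sat M F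
    outof F (x∉F , p∉F) = subst id (sat-update₂ M x v p w F x∉F p∉F)

  implied′ : A ∧ᶠ (¬_⇂A V mode (C₁ ++ C₂)) ⊨ J
  implied′ M (satA , sat¬C) = outof J absent-J (plug-mono M′ I₁ EQ⇒I₂ satI₁)
    where
    open Update M (⟦_⟧ M a) false

    satA′ : sat M′ A
    satA′ = into A (freshA (eqVar a b) , freshA (eqProp a b)) satA

    sat¬C₁₂ : sat M (¬_⇂A V mode C₁) × sat M (¬_⇂A V mode C₂)
    sat¬C₁₂ = sat-⋀-++ M _ C₁ sat¬C

    sat¬C₁ : sat M′ (¬_⇂A V mode C₁)
    sat¬C₁ = into (¬_⇂A V mode C₁) (absent₁ (_↓A V mode) (symb-↓A V mode)) (proj₁ sat¬C₁₂)

    sat¬C₂ : sat M′ (¬_⇂A V mode C₂)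
    sat¬C₂ = into (¬_⇂A V mode C₂) (absent₂ (_↓A V mode) (symb-↓A V mode)) (proj₂ sat¬C₁₂)

    a≡x : ⟦_⟧ M′ a ≡ ⟦_⟧ M′ (app x [])
    a≡x = trans (value a absent-a) (sym value-x)

    ¬p : ¬ (⟦_⟧ M′ (app p []) ≡ true)
    ¬p p≡true with () ← trans (sym value-p) p≡true

    satI₁ : sat M′ (plug I₁ (λ i → EQ p x (s i)))
    satI₁ = PI₁.implied M′ (satA′ , inj₂ (¬p , a≡x) , sat¬C₁)

    satI₂ : sat M′ I₂
    satI₂ = PI₂.implied M′ (satA′ , a≡x , sat¬C₂)

    EQ⇒I₂ : ∀ i → sat M′ (EQ p x (s i)) → sat M′ (I₂ [ x ≔ s i ])
    EQ⇒I₂ i (inj₁ (p≡true , _)) = ⊥-elim (¬p p≡true)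
    EQ⇒I₂ i (inj₂ (_ , x≡s))    = subst id (sym (sat-sub M′ x (s i) x≡s I₂)) satI₂

  inconsistent′ : B ∧ᶠ (¬_⇂B V mode (C₁ ++ C₂)) ∧ᶠ J ⊨ ⊥ᶠ
  inconsistent′ M (satB , sat¬C , satJ) =
    PI₁.inconsistent M′
      ( satB′
      , (inj₂ ((λ ¬p → ¬p value-p) , x≡b) , sat¬C₁)
      , plug-mono M′ I₁ I₂⇒EQ (into J absent-J satJ))
    where
    open Update M (⟦_⟧ M b) true

    satB′ : sat M′ B
    satB′ = into B (freshB (eqVar a b) , freshB (eqProp a b)) satB

    sat¬C₁₂ : sat M (¬_⇂B V mode C₁) × sat M (¬_⇂B V mode C₂)
    sat¬C₁₂ = sat-⋀-++ M _ C₁ sat¬C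

    sat¬C₁ : sat M′ (¬_⇂B V mode C₁)
    sat¬C₁ = into (¬_⇂B V mode C₁) (absent₁ (_↓B V mode) (symb-↓B V mode)) (proj₁ sat¬C₁₂)

    sat¬C₂ : sat M′ (¬_⇂B V mode C₂)
    sat¬C₂ = into (¬_⇂B V mode C₂) (absent₂ (_↓B V mode) (symb-↓B V mode)) (proj₂ sat¬C₁₂)

    x≡b : ⟦_⟧ M′ (app x []) ≡ ⟦_⟧ M′ b
    x≡b = trans value-x (sym (value b absent-b))

    I₂⇒EQ : ∀ i → sat M′ (I₂ [ x ≔ s i ]) → sat M′ (EQ p x (s i))
    I₂⇒EQ i satI₂s = inj₁ (value-p , λ x≡s →
      PI₂.inconsistent M′
        (satB′ , (x≡b , sat¬C₂) , subst id (sat-sub M′ x (s i) x≡s I₂) satI₂s))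

  symbols′ : ∀ {f} → f ∈ symb J → SharedSym f ⊎ f ∈ auxᶜ V mode (C₁ ++ C₂)
  symbols′ {f} f∈J = [ fromI₁ , fromI₂ ]′ (symb-plug I₁ _ (λ i → EQ p x (s i)) atHole f∈J)
    where
    f≢x : f ≢ symbol {S} x
    f≢x refl = proj₁ absent-J f∈J

    f≢p : f ≢ symbol {S} p
    f≢p refl = proj₂ absent-J f∈J

    -- In EQ(x,sᵢ) the symbols of sᵢ follow p and x.
    atHole : ∀ i → f ∈ symb (I₂ [ x ≔ s i ]) → f ∈ symb (EQ p x (s i)) ⊎ f ∈ symb I₂
    atHole i f∈ with symb-sub x (s i) I₂ f∈
    ... | inj₁ (f∈I₂ , _) = inj₂ f∈I₂
    ... | inj₂ f∈s        = inj₁ (there (there (∈-++⁺ˡ f∈s)))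

    auxOf : ProofLiteral {S} → List (Symbol {S})
    auxOf ℓ = aux V mode (negation ℓ)

    fromI₁ : f ∈ symb (plug I₁ (λ i → EQ p x (s i))) →
             SharedSym f ⊎ f ∈ auxᶜ V mode (C₁ ++ C₂)
    fromI₁ f∈ with PI₁.symbols f∈
    ... | inj₁ f-shared            = inj₁ f-shared
    ... | inj₂ (here f≡x)          = ⊥-elim (f≢x f≡x)
    ... | inj₂ (there (here f≡p))  = ⊥-elim (f≢p f≡p)
    ... | inj₂ (there (there f∈C)) = inj₂ (∈-concatMap⁺ˡ auxOf C₁ f∈C)

    fromI₂ : f ∈ symb I₂ → SharedSym f ⊎ f ∈ auxᶜ V mode (C₁ ++ C₂)
    fromI₂ f∈ with PI₂.symbols f∈
    ... | inj₁ f-shared    = inj₁ f-shared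
    ... | inj₂ (here f≡x)  = ⊥-elim (f≢x f≡x)
    ... | inj₂ (there f∈C) = inj₂ (∈-concatMap⁺ʳ auxOf C₁ f∈C)
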